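{- Let $G$ be a snark with a non-removable pair of adjacent vertices $\{u,v\}$, and let $\bar G$ be the snark arising from $G$ by inflating both $u$ and $v$ to a triangle. Then $3\le \operatorname{df}(\bar G)\le 4$.
   Context: Graphs are finite and undirected; parallel edges and loops are permitted. A snark is a $2$-connected cubic graph that does not admit a $3$-edge-colouring (an assignment of three colours to edges with adjacent edges receiving distinct colours). A pair $\{u,v\}$ of vertices of a snark $G$ is non-removable if the graph $G-\{u,v\}$ obtained by deleting $u$ and $v$ is $3$-edge-colourable. Inflating a vertex $w$ with incident edges $e_1,e_2,e_3$ to a triangle means replacing $w$ by three new mutually adjacent vertices $w_1,w_2,w_3$ and making $e_i$ incident with $w_i$ instead of $w$ ($i=1,2,3$). A $3$-array of a cubic graph is a collection of three (not necessarily distinct) perfect matchings; an edge is uncovered if it belongs to none of them. The defect $\operatorname{df}(H)$ of a bridgeless cubic graph $H$ is the minimum number of uncovered edges over all $3$-arrays of $H$. -}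

module Defs where

open import Data.Nat using (ℕ; _≤_)
open import Data.Fin using (Fin; zero; suc)
open import Data.Bool using (Bool; true; false; _∨_; not)
open import Data.Product using (Σ; _×_; _,_; proj₁; proj₂)
open import Data.Sum using (_⊎_; inj₁; inj₂)
open import Data.Unit using (⊤)
open import Relation.Nullary using (¬_; yes; no)
open import Relation.Nullary.Decidable using (False; fromWitnessFalse)
open import Relation.Binary.Definitions using (DecidableEquality)
open import Relation.Binary.PropositionalEquality using (_≡_; _≢_)
open import Function.Bundles using (_↔_; Inverse)

-- Finite undirected multigraphs (parallel edges and loops allowed).
-- Each edge e has two ends, end e zero and end e (suc zero);
-- a loop is an edge whose two ends coincide.

record Graph : Set₁ where
  field
    V   : Set
    E   : Set
    end : E → Fin 2 → V

open Graph public

oth : Fin 2 → Fin 2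
oth zero = suc zero
oth (suc _) = zero

Finite : Graph → Set
Finite G = (Σ ℕ λ n → V G ↔ Fin n) × (Σ ℕ λ m → E G ↔ Fin m)

-- Half-edges (edge-ends) at a vertex v; a loop contributes two.
Half : (G : Graph) → V G → Set
Half G v = Σ (E G × Fin 2) λ h → end G (proj₁ h) (proj₂ h) ≡ v

Cubic : Graph → Set
Cubic G = ∀ v → Half G v ↔ Fin 3

InP : (G : Graph) → (V G → Set) → E G → Set
InP G P e = (i : Fin 2) → P (end G e i)

data Reach (G : Graph) (P : V G → Set) : V G → V G → Set where
  here : ∀ {x} → P x → Reach G P x x
  step : ∀ {y} (e : E G) (i : Fin 2) → InP G P e →
         Reach G P (end G e (oth i)) y → Reach G P (end G e i) y

ConnectedOn : (G : Graph) → (V G → Set) → Set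
ConnectedOn G P = ∀ x y → P x → P y → Reach G P x y

Connected : Graph → Set
Connected G = ConnectedOn G (λ _ → ⊤)

TwoConnected : Graph → Set
TwoConnected G = Connected G × (∀ w → ConnectedOn G (λ x → x ≢ w))

-- Proper 3-edge-colouring of the subgraph induced by P: two distinct
-- half-edges at a common vertex get distinct colours (so loops are
-- never properly colourable, parallel edges get distinct colours).
Colouring3On : (G : Graph) → (V G → Set) → (E G → Fin 3) → Set
Colouring3On G P c =
  ∀ e i e' i' → InP G P e → InP G P e' →
  end G e i ≡ end G e' i' → (e , i) ≢ (e' , i') → c e ≢ c e'

Colourable3On : (G : Graph) → (V G → Set) → Set
Colourable3On G P = Σ (E G → Fin 3) (Colouring3On G P)

Colourable3 : Graph → Set
Colourable3 G = Colourable3On G (λ _ → ⊤)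

Snark : Graph → Set
Snark G = Finite G × TwoConnected G × Cubic G × ¬ Colourable3 G

Adjacent : (G : Graph) → V G → V G → Set
Adjacent G u v = Σ (E G) λ e →
  (end G e zero ≡ u × end G e (suc zero) ≡ v) ⊎
  (end G e zero ≡ v × end G e (suc zero) ≡ u)

NonRemovable : (G : Graph) → V G → V G → Set
NonRemovable G u v = u ≢ v × Colourable3On G (λ x → x ≢ u × x ≢ v)

PerfectMatching : (G : Graph) → (E G → Bool) → Set
PerfectMatching G M =
  ∀ v → Σ (Half G v) (λ h → M (proj₁ (proj₁ h)) ≡ true) ×
        (∀ (h h' : Half G v) → M (proj₁ (proj₁ h)) ≡ true →
           M (proj₁ (proj₁ h')) ≡ true → proj₁ h ≡ proj₁ h')

record ThreeArray (G : Graph) : Set where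
  field
    M₁ M₂ M₃ : E G → Bool
    pm₁ : PerfectMatching G M₁
    pm₂ : PerfectMatching G M₂
    pm₃ : PerfectMatching G M₃

UncoveredCount : (G : Graph) → ThreeArray G → ℕ → Set
UncoveredCount G A k =
  (Σ (E G) λ e → not (M₁ e ∨ M₂ e ∨ M₃ e) ≡ true) ↔ Fin k
  where open ThreeArray A

IsDefect : Graph → ℕ → Set
IsDefect H d =
  (Σ (ThreeArray H) λ A → UncoveredCount H A d) ×
  (∀ (A : ThreeArray H) k → UncoveredCount H A k → d ≤ k)

-- Inflating two distinct vertices u and v to triangles.
-- σu, σv enumerate the three half-edges at u resp. v (the e₁,e₂,e₃ of
-- the definition); the half-edge numbered i is re-attached to the new
-- vertex number i of the corresponding triangle.

module Inflate (G : Graph) (_≟_ : DecidableEquality (V G)) (u v : V G)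
               (σu : Half G u ↔ Fin 3) (σv : Half G v ↔ Fin 3) where

  -- old vertices other than u, v; plus triangle vertices (true = u, false = v)
  V' : Set
  V' = (Σ (V G) λ x → False (x ≟ u) × False (x ≟ v)) ⊎ (Bool × Fin 3)

  -- old edges; plus triangle edges (b , k) joining (b , k) and (b , k+1 mod 3)
  E' : Set
  E' = E G ⊎ (Bool × Fin 3)

  next : Fin 3 → Fin 3
  next zero = suc zero
  next (suc zero) = suc (suc zero)
  next (suc (suc zero)) = zero

  place : (x : V G) → (x ≡ u → Fin 3) → (x ≡ v → Fin 3) → V'
  place x fu fv with x ≟ u | x ≟ v
  ... | yes p | _     = inj₂ (true , fu p)
  ... | no ¬p | yes q = inj₂ (false , fv q)
  ... | no ¬p | no ¬q = inj₁ (x , fromWitnessFalse ¬p , fromWitnessFalse ¬q)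

  end' : E' → Fin 2 → V'
  end' (inj₁ e) i = place (end G e i)
    (λ p → Inverse.to σu ((e , i) , p))
    (λ q → Inverse.to σv ((e , i) , q))
  end' (inj₂ (b , k)) zero = inj₂ (b , k)
  end' (inj₂ (b , k)) (suc _) = inj₂ (b , next k)

  graph : Graph
  graph = record { V = V' ; E = E' ; end = end' }

inflate2 : (G : Graph) → DecidableEquality (V G) → (u v : V G) →
           Half G u ↔ Fin 3 → Half G v ↔ Fin 3 → Graph
inflate2 G _≟_ u v σu σv = Inflate.graph G _≟_ u v σu σv

{-# OPTIONS --safe #-}
module Submission where

-- Lower bound: count half-edges. If e lies in m(e) of the three matchings of a 3-array, then
-- Σ m(e) = |E|, so the number k of uncovered edges is the number of doubly covered edges plus
-- twice the number of triply covered ones. For k ≤ 2 a loopless cubic graph is 3-edge-colourable: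
-- if no edge is triply covered, the at most two doubly covered edges have a common matching, which
-- is moved from them to the uncovered edges; otherwise no edge is doubly covered, and the two
-- uncovered edges together with the triply covered one form a theta component. Inflated graphs are
-- not colourable, because a colouring survives the contraction of a triangle.
--
-- Upper bound: extend the colouring of G − {u,v} so that all other vertices see three colours.
-- By parity, and because G is not colourable, the two edges at u other than e = uv have the same
-- colour, and likewise at v. Each colour class together with e, and with the edge opposite to e in
-- each triangle that the class does not enter, is a perfect matching of the inflated graph; only
-- the four triangle edges adjacent to e remain uncovered.

open import Defs
open import Algebra.Bundles using (CommutativeMonoid; CommutativeRing)
import Algebra.Properties.CommutativeMonoid.Sum as MonoidSum
open import Data.Bool using (Bool; true; false; _∨_; _∧_; not; _xor_)
import Data.Bool.Properties as Bool
open import Data.Empty using (⊥; ⊥-elim)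
open import Data.Fin using (Fin; zero; suc; _≟_; _↑ˡ_; _↑ʳ_; combine; inject≤; inject₁; remQuot)
open import Data.Fin.Patterns using (0F; 1F; 2F)
open import Data.Fin.Permutation using (Permutation; ↔⇒≡)
open import Data.Fin.Properties using
  (*↔×; +↔⊎; 2↔Bool; all?; any?; combine-injective; inject≤-injective; injective⇒≤;
   remQuot-combine; suc-injective)
open import Data.Fin.Subset using (Subset)
open import Data.Fin.Subset.Properties using (anySubset?)
open import Data.Nat using (ℕ; zero; suc; _≤_; _+_; _*_; z≤n; s≤s)
import Data.Nat.Properties as ℕ
open import Data.Product using (Σ; _×_; _,_; proj₁; proj₂; uncurry)
open import Data.Product.Function.NonDependent.Propositional using (_×-↔_)
open import Data.Sum using (_⊎_; inj₁; inj₂)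
open import Data.Sum.Properties using (inj₂-injective)
open import Data.Sum.Function.Propositional using (_⊎-↔_)
open import Data.Vec using (lookup; tabulate)
open import Data.Vec.Properties using (lookup∘tabulate)
open import Function using (_∘_; id)
open import Function.Bundles using (_↔_; Inverse; mk↔ₛ′)
open import Function.Properties.Inverse using (↔-refl; ↔-sym; ↔-trans; ↔⇒↣)
open import Relation.Binary.Definitions using (DecidableEquality)
open import Relation.Binary.PropositionalEquality using
  (_≡_; _≢_; refl; sym; trans; cong; cong₂; subst)
open import Relation.Binary.PropositionalEquality.WithK using (≡-irrelevant)
open import Relation.Nullary using (¬_; Dec; yes; no; does; contradiction)
open import Relation.Nullary.Decidable using
  (False; _×-dec_; _→-dec_; _⊎-dec_; ¬?; dec-false; dec-true; from-yes;
   fromWitnessFalse; map′; toWitnessFalse; via-injection)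

-- Finite sums in a commutative monoid.

module _ {a ℓ} (M : CommutativeMonoid a ℓ) where
  open CommutativeMonoid M renaming (refl to ≈-refl; sym to ≈-sym; trans to ≈-trans)
  open MonoidSum M

  sum-split : ∀ m {n} (g : Fin (m + n) → Carrier) →
    sum g ≈ sum (λ i → g (i ↑ˡ n)) ∙ sum (λ j → g (m ↑ʳ j))
  sum-split zero g = ≈-sym (identityˡ _)
  sum-split (suc m) g = ≈-trans (∙-congˡ (sum-split m (g ∘ suc))) (≈-sym (assoc _ _ _))

  sum-combine : ∀ m {n} (g : Fin (m * n) → Carrier) →
    sum (λ i → sum (λ j → g (combine {m} i j))) ≈ sum g
  sum-combine zero g = ≈-refl
  sum-combine (suc m) {n} g =
    ≈-trans (∙-congˡ (sum-combine m (λ k → g (n ↑ʳ k)))) (≈-sym (sum-split n g))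

  -- Flattening a double sum to a single index lets a bijection of half-edges act on it as a
  -- permutation.
  sum-remQuot : ∀ m {n} (g : Fin m → Fin n → Carrier) →
    sum (λ i → sum (g i)) ≈ sum (λ k → uncurry g (remQuot {m} n k))
  sum-remQuot m {n} g = ≈-trans
    (sum-cong-≋ λ i → sum-cong-≋ λ j →
      reflexive (cong (uncurry g) (sym (remQuot-combine {m} {n} i j))))
    (sum-combine m (λ k → uncurry g (remQuot {m} n k)))

  sum-zero : ∀ {n} (g : Fin n → Carrier) → (∀ k → g k ≈ ε) → sum g ≈ ε
  sum-zero {n} g g≈ε = ≈-trans (sum-cong-≋ g≈ε) (sum-replicate-zero n)

  sum-single : ∀ {n} (g : Fin n → Carrier) i → (∀ k → k ≢ i → g k ≈ ε) → sum g ≈ g i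
  sum-single g zero off =
    ≈-trans (∙-congˡ (sum-zero (g ∘ suc) (λ k → off (suc k) λ ()))) (identityʳ _)
  sum-single g (suc i) off = ≈-trans
    (∙-cong (off zero λ ()) (sum-single (g ∘ suc) i (λ k k≢i → off (suc k) (k≢i ∘ suc-injective))))
    (identityˡ _)

  -- Meant for the parity argument, where only the terms of `u` and `v` survive.
  sum-pair : ∀ {n} (g : Fin n → Carrier) i j → i ≢ j →
    (∀ k → k ≢ i → k ≢ j → g k ≈ ε) → sum g ≈ g i ∙ g j
  sum-pair g zero zero i≢j off = contradiction refl i≢j
  sum-pair g zero (suc j) i≢j off =
    ∙-congˡ (sum-single (g ∘ suc) j (λ k k≢j → off (suc k) (λ ()) (k≢j ∘ suc-injective)))
  sum-pair g (suc i) zero i≢j off = ≈-trans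
    (∙-congˡ (sum-single (g ∘ suc) i (λ k k≢i → off (suc k) (k≢i ∘ suc-injective) (λ ()))))
    (comm _ _)
  sum-pair g (suc i) (suc j) i≢j off = ≈-trans
    (∙-cong (off zero (λ ()) λ ())
      (sum-pair (g ∘ suc) i j (i≢j ∘ cong suc)
        (λ k k≢i k≢j → off (suc k) (k≢i ∘ suc-injective) (k≢j ∘ suc-injective))))
    (identityˡ _)

-- Finite cubic graphs and double counting of half-edges.

record FiniteCubic (G : Graph) : Set where
  field
    {nV nE}    : ℕ
    enumV      : V G ↔ Fin nV
    enumE      : E G ↔ Fin nE
    -- Cubicity without the dependent type `Half`: the three equations below make the half-edges
    -- correspond bijectively to pairs of a vertex and a position in `Fin 3`.
    half       : V G → Fin 3 → E G × Fin 2
    index      : E G → Fin 2 → Fin 3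
    end-half   : ∀ w t → uncurry (end G) (half w t) ≡ w
    half-index : ∀ e i → half (end G e i) (index e i) ≡ (e , i)
    index-half : ∀ w t → uncurry index (half w t) ≡ t

  edge : V G → Fin 3 → E G
  edge w t = proj₁ (half w t)

  vtx : Fin nV → V G
  vtx = Inverse.from enumV

  edg : Fin nE → E G
  edg = Inverse.from enumE

  half-injective : ∀ w {s t} → half w s ≡ half w t → s ≡ t
  half-injective w {s} {t} eq =
    trans (sym (index-half w s)) (trans (cong (uncurry index) eq) (index-half w t))

  half-at : ∀ {w} e i → end G e i ≡ w → half w (index e i) ≡ (e , i)
  half-at e i refl = half-index e i

  halves : (E G × Fin 2) ↔ (V G × Fin 3)
  halves = mk↔ₛ′ (λ (e , i) → end G e i , index e i) (uncurry half)
    (λ (w , t) → cong₂ _,_ (end-half w t) (index-half w t))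
    (λ (e , i) → half-index e i)

  -- Both sides sum f over all half-edges.
  module _ {a ℓ} (M : CommutativeMonoid a ℓ) where
    open CommutativeMonoid M renaming (refl to ≈-refl; sym to ≈-sym; trans to ≈-trans)
    open MonoidSum M

    handshake : (f : E G → Carrier) →
      sum {2} (λ _ → sum (f ∘ edg)) ≈ sum (λ k → sum (f ∘ edge (vtx k)))
    handshake f = ≈-trans (∑-comm {2} (λ _ → f ∘ edg))
      (≈-trans (sum-remQuot M nE (λ k (_ : Fin 2) → f (edg k)))
      (≈-sym (≈-trans (sum-remQuot M nV (λ k → f ∘ edge (vtx k)))
      (≈-trans (sum-permute {nE * 2} (λ k → uncurry (λ j → f ∘ edge (vtx j)) (remQuot {nV} 3 k)) π)
        (sum-cong-≋ λ k → reflexive (cong f (π-edge k)))))))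
      where
      -- `π` passes from the code of a half-edge by edge and end to its code by vertex and position.
      π : Permutation (nE * 2) (nV * 3)
      π = ↔-trans (*↔× {nE} {2}) (↔-trans (↔-sym enumE ×-↔ ↔-refl)
            (↔-trans halves (↔-trans (enumV ×-↔ ↔-refl) (↔-sym (*↔× {nV} {3})))))
      π-edge : ∀ k → uncurry (λ j → edge (vtx j)) (remQuot {nV} 3 (Inverse.to π k))
                 ≡ edg (proj₁ (remQuot {nE} 2 k))
      π-edge k = trans
        (cong (uncurry (λ j → edge (vtx j)))
          (remQuot-combine (Inverse.to enumV (end G e i)) (index e i)))
        (trans (cong (λ w → edge w (index e i)) (Inverse.strictlyInverseʳ enumV _))
          (cong proj₁ (half-index e i)))
        where
        e = edg (proj₁ (remQuot {nE} 2 k))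
        i = proj₂ (remQuot {nE} 2 k)

-- Sizes of subsets as sums of indicators.

open MonoidSum ℕ.+-0-commutativeMonoid using (sum; sum-cong-≗; ∑-distrib-+)

xorMonoid : CommutativeMonoid _ _
xorMonoid = CommutativeRing.+-commutativeMonoid Bool.xor-∧-commutativeRing

open MonoidSum xorMonoid using () renaming (sum to xorSum)

⟦_⟧ : Bool → ℕ
⟦ true ⟧ = 1
⟦ false ⟧ = 0

true-prop : ∀ {b} (p q : b ≡ true) → p ≡ q
true-prop refl refl = refl

Fin-filter : ∀ {n} (z : Fin n → Bool) → (Σ (Fin n) λ k → z k ≡ true) ↔ Fin (sum (⟦_⟧ ∘ z))
Fin-filter {zero} z = mk↔ₛ′ (λ ()) (λ ()) (λ ()) (λ ())
Fin-filter {suc n} z with z zero in eq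
... | true = mk↔ₛ′ to from to-from from-to
  where
  open Inverse (Fin-filter (z ∘ suc)) renaming (to to to′; from to from′)
  to : Σ (Fin (suc n)) (λ k → z k ≡ true) → Fin (suc (sum (⟦_⟧ ∘ z ∘ suc)))
  to (zero , _) = zero
  to (suc k , p) = suc (to′ (k , p))
  from : Fin (suc (sum (⟦_⟧ ∘ z ∘ suc))) → Σ (Fin (suc n)) (λ k → z k ≡ true)
  from zero = zero , eq
  from (suc j) = suc (proj₁ (from′ j)) , proj₂ (from′ j)
  to-from : ∀ j → to (from j) ≡ j
  to-from zero = refl
  to-from (suc j) = cong suc (strictlyInverseˡ j)
  from-to : ∀ k → from (to k) ≡ k
  from-to (zero , p) = cong (zero ,_) (true-prop eq p)
  from-to (suc k , p) = cong (λ (j , q) → suc j , q) (strictlyInverseʳ (k , p))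
... | false = mk↔ₛ′ to from strictlyInverseˡ from-to
  where
  open Inverse (Fin-filter (z ∘ suc)) renaming (to to to′; from to from′)
  to : Σ (Fin (suc n)) (λ k → z k ≡ true) → Fin (sum (⟦_⟧ ∘ z ∘ suc))
  to (zero , p) = contradiction (trans (sym eq) p) λ ()
  to (suc k , p) = to′ (k , p)
  from : Fin (sum (⟦_⟧ ∘ z ∘ suc)) → Σ (Fin (suc n)) (λ k → z k ≡ true)
  from j = suc (proj₁ (from′ j)) , proj₂ (from′ j)
  from-to : ∀ k → from (to k) ≡ k
  from-to (zero , p) = contradiction (trans (sym eq) p) λ ()
  from-to (suc k , p) = cong (λ (j , q) → suc j , q) (strictlyInverseʳ (k , p))

Σ-true-≡ : ∀ {A : Set} {z : A → Bool} {x y : Σ A λ a → z a ≡ true} → proj₁ x ≡ proj₁ y → x ≡ y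
Σ-true-≡ {x = a , p} {_ , q} refl = cong (a ,_) (true-prop p q)

-- Expresses the size of a decidable subset as a sum, so that sum identities and double counting
-- apply to it.
filter : ∀ {A : Set} {n} (enum : A ↔ Fin n) (z : A → Bool) →
  (Σ A λ a → z a ≡ true) ↔ Fin (sum (⟦_⟧ ∘ z ∘ Inverse.from enum))
filter {A} enum z = ↔-trans
  (mk↔ₛ′ (λ (a , p) → to a , trans (cong z (strictlyInverseʳ a)) p)
         (λ (k , p) → from k , p)
         (λ (k , p) → Σ-true-≡ (strictlyInverseˡ k))
         (λ (a , p) → Σ-true-≡ (strictlyInverseʳ a)))
  (Fin-filter (z ∘ from))
  where
  open Inverse enum

sum≡0⇒≡0 : ∀ {n} (g : Fin n → ℕ) → sum g ≡ 0 → ∀ k → g k ≡ 0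
sum≡0⇒≡0 g eq zero = ℕ.m+n≡0⇒m≡0 (g zero) eq
sum≡0⇒≡0 g eq (suc k) = sum≡0⇒≡0 (g ∘ suc) (ℕ.m+n≡0⇒n≡0 (g zero) eq) k

-- Perfect matchings, vertex by vertex.

ExactlyOne : (Fin 3 → Bool) → Set
ExactlyOne b = Σ (Fin 3) λ t₀ → ∀ t → b t ≡ does (t ≟ t₀)

module Matchings {G : Graph} (C : FiniteCubic G) where
  open FiniteCubic C

  -- The matched position is data. Thus a 3-array is described at each vertex by three elements of
  -- `Fin 3`, and local claims become finite checks.
  Perfect : (E G → Bool) → Set
  Perfect M = ∀ w → ExactlyOne (M ∘ edge w)

  matching⇒perfect : ∀ {M} → PerfectMatching G M → Perfect M
  matching⇒perfect {M} pm w with pm w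
  ... | (((e , i) , refl) , Me) , unique = index e i , value
    where
    value : ∀ t → M (edge w t) ≡ does (t ≟ index e i)
    value t with t ≟ index e i
    ... | yes refl = trans (cong (M ∘ proj₁) (half-index e i)) Me
    ... | no t≢ = Bool.¬-not λ Mt → t≢ (half-injective w
      (trans (unique (half w t , end-half w t) ((e , i) , refl) Mt Me) (sym (half-index e i))))

  perfect⇒matching : ∀ {M} → Perfect M → PerfectMatching G M
  perfect⇒matching {M} p w with p w
  ... | t₀ , value =
    ((half w t₀ , end-half w t₀) , trans (value t₀) (dec-true (t₀ ≟ t₀) refl)) ,
    λ h h′ Mh Mh′ → trans (unique h Mh) (sym (unique h′ Mh′))
    where
    unique : (h : Half G w) → M (proj₁ (proj₁ h)) ≡ true → proj₁ h ≡ half w t₀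
    unique ((e , i) , refl) Me with index e i ≟ t₀
      | trans (sym (value (index e i))) (trans (cong (M ∘ proj₁) (half-index e i)) Me)
    ... | yes refl | _ = sym (half-index e i)
    ... | no _ | ()

  perfect? : ∀ M → Dec (Perfect M)
  perfect? M with all? (λ k → any? λ t₀ → all? λ t → M (edge (vtx k) t) Bool.≟ does (t ≟ t₀))
  ... | yes p = yes λ w → subst (ExactlyOne ∘ λ x → M ∘ edge x) (Inverse.strictlyInverseʳ enumV w)
                                (p (Inverse.to enumV w))
  ... | no ¬p = no λ p → ¬p (p ∘ vtx)

  -- Distinct half-edges at a vertex have distinct positions. A loop would take two positions with
  -- one colour, so injectivity excludes loops as well.
  local⇒colouring : (c : E G → Fin 3) → (∀ w {s t} → c (edge w s) ≡ c (edge w t) → s ≡ t) →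
    Colourable3 G
  local⇒colouring c inj = c , λ e i e′ i′ _ _ same h≢h′ eq → h≢h′
    (trans (sym (half-at e i same))
      (trans (cong (half (end G e′ i′)) (inj (end G e′ i′)
          (trans (cong (c ∘ proj₁) (half-at e i same))
            (trans eq (sym (cong (c ∘ proj₁) (half-index e′ i′)))))))
        (half-index e′ i′)))

-- Local patterns of three matchings.

module _ (a b c : Bool) where
  multiplicity : ℕ
  multiplicity = ⟦ a ⟧ + (⟦ b ⟧ + ⟦ c ⟧)

  uncovered thrice : Bool
  uncovered = not (a ∨ b ∨ c)
  thrice = a ∧ b ∧ c

-- Doubly covered edges are sorted by the matching that misses them: if class `i` is empty, the
-- `i`-th matching contains all of them.
twiceWithout : Fin 3 → Bool → Bool → Bool → Bool
twiceWithout 0F a b c = not a ∧ b ∧ c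
twiceWithout 1F a b c = a ∧ not b ∧ c
twiceWithout 2F a b c = a ∧ b ∧ not c

-- The excess m(e) - 1 is -1, 0, 1, 2 for m(e) = 0, 1, 2, 3; the -1 is moved to the left to stay
-- within ℕ.
multiplicity-excess : ∀ a b c → multiplicity a b c + ⟦ uncovered a b c ⟧ ≡
  1 + (⟦ twiceWithout 0F a b c ⟧ + (⟦ twiceWithout 1F a b c ⟧ + (⟦ twiceWithout 2F a b c ⟧
     + (⟦ thrice a b c ⟧ + ⟦ thrice a b c ⟧))))
multiplicity-excess true true true = refl
multiplicity-excess true true false = refl
multiplicity-excess true false true = refl
multiplicity-excess true false false = refl
multiplicity-excess false true true = refl
multiplicity-excess false true false = refl
multiplicity-excess false false true = refl
multiplicity-excess false false false = refl

-- Recolouring when every doubly covered edge lies in the i-th matching: move that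
-- matching from the doubly covered edges to the uncovered ones. The other values are junk.
shiftColour : Fin 3 → Bool → Bool → Bool → Fin 3
shiftColour i false false false = i
shiftColour i true false false = 0F
shiftColour i false true false = 1F
shiftColour i false false true = 2F
shiftColour 0F true true _ = 1F
shiftColour _ true true _ = 0F
shiftColour 0F true false true = 2F
shiftColour _ true false true = 0F
shiftColour 1F false true true = 2F
shiftColour _ false true true = 1F

-- Colouring when no edge is doubly covered, given colours 0, 1 for the uncovered edges.
thetaColour : Fin 2 → Bool → Bool → Bool → Fin 3
thetaColour z false false false = inject₁ z
thetaColour z true false false = 0F
thetaColour z false true false = 1F
thetaColour z _ _ _ = 2F

-- The pattern at a vertex where the k-th matching uses the half-edge tₖ.
pattern₃ : ∀ {A : Set} → (Bool → Bool → Bool → A) → Fin 3 → Fin 3 → Fin 3 → Fin 3 → A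
pattern₃ f t₀ t₁ t₂ t = f (does (t ≟ t₀)) (does (t ≟ t₁)) (does (t ≟ t₂))

abstract
  multiplicity-sum : ∀ t₀ t₁ t₂ → sum (pattern₃ multiplicity t₀ t₁ t₂) ≡ 3
  multiplicity-sum = from-yes (all? λ t₀ → all? λ t₁ → all? λ t₂ →
    sum (pattern₃ multiplicity t₀ t₁ t₂) ℕ.≟ 3)

  -- Either the three choices differ, or one half-edge is chosen twice, one once and one never. In
  -- the second case matching `i` passes from the first to the last, and again each matching is used
  -- once.
  shiftColour-injective : ∀ i t₀ t₁ t₂ →
    (∀ t → pattern₃ (twiceWithout i) t₀ t₁ t₂ t ≡ false) →
    (∀ t → pattern₃ thrice t₀ t₁ t₂ t ≡ false) →
    ∀ s t → pattern₃ (shiftColour i) t₀ t₁ t₂ s ≡ pattern₃ (shiftColour i) t₀ t₁ t₂ t → s ≡ t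
  shiftColour-injective = from-yes (all? λ i → all? λ t₀ → all? λ t₁ → all? λ t₂ →
    (all? λ t → pattern₃ (twiceWithout i) t₀ t₁ t₂ t Bool.≟ false) →-dec
    (all? λ t → pattern₃ thrice t₀ t₁ t₂ t Bool.≟ false) →-dec
    (all? λ s → all? λ t →
      (pattern₃ (shiftColour i) t₀ t₁ t₂ s ≟ pattern₃ (shiftColour i) t₀ t₁ t₂ t) →-dec (s ≟ t)))

  -- Without doubly covered half-edges the three choices are all distinct or all equal. If equal,
  -- the chosen half-edge has colour 2, and the two others are uncovered and coloured by their
  -- labels.
  thetaColour-collision : ∀ t₀ t₁ t₂ →
    (∀ i t → pattern₃ (twiceWithout i) t₀ t₁ t₂ t ≡ false) →
    ∀ s t y z → pattern₃ (thetaColour y) t₀ t₁ t₂ s ≡ pattern₃ (thetaColour z) t₀ t₁ t₂ t →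
    s ≡ t ⊎ (pattern₃ uncovered t₀ t₁ t₂ s ≡ true × pattern₃ uncovered t₀ t₁ t₂ t ≡ true × y ≡ z)
  thetaColour-collision = from-yes (all? λ t₀ → all? λ t₁ → all? λ t₂ →
    (all? λ i → all? λ t → pattern₃ (twiceWithout i) t₀ t₁ t₂ t Bool.≟ false) →-dec
    (all? λ s → all? λ t → all? λ y → all? λ z →
      (pattern₃ (thetaColour y) t₀ t₁ t₂ s ≟ pattern₃ (thetaColour z) t₀ t₁ t₂ t) →-dec
      ((s ≟ t) ⊎-dec ((pattern₃ uncovered t₀ t₁ t₂ s Bool.≟ true) ×-dec
        ((pattern₃ uncovered t₀ t₁ t₂ t Bool.≟ true) ×-dec (y ≟ z))))))

tri : ∀ {A : Set} → A → A → A → Fin 3 → A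
tri a b c 0F = a
tri a b c 1F = b
tri a b c 2F = c

tri-η : ∀ {A : Set} (f : Fin 3 → A) t → tri (f 0F) (f 1F) (f 2F) t ≡ f t
tri-η f 0F = refl
tri-η f 1F = refl
tri-η f 2F = refl

-- If d = 0, then a, b, c cannot all be positive. If d is positive, then d + d already exhausts the
-- bound 2.
excess-cases : ∀ a b c d → a + (b + (c + (d + d))) ≤ 2 →
  (d ≡ 0 × Σ (Fin 3) λ i → tri a b c i ≡ 0) ⊎ (a ≡ 0 × b ≡ 0 × c ≡ 0)
excess-cases zero _ _ zero _ = inj₁ (refl , 0F , refl)
excess-cases (suc _) zero _ zero _ = inj₁ (refl , 1F , refl)
excess-cases (suc _) (suc _) zero zero _ = inj₁ (refl , 2F , refl)
excess-cases (suc a) (suc b) (suc c) zero h = contradiction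
  (ℕ.≤-trans (ℕ.+-mono-≤ {1} (s≤s z≤n) (ℕ.+-mono-≤ {1} (s≤s z≤n)
    (ℕ.+-mono-≤ {1} {suc c} {0} (s≤s z≤n) z≤n))) h)
  λ { (s≤s (s≤s ())) }
excess-cases a b c (suc d) h = inj₂
  ( ℕ.m+n≡0⇒m≡0 a small
  , ℕ.m+n≡0⇒m≡0 b (ℕ.m+n≡0⇒n≡0 a small)
  , ℕ.m+n≡0⇒n≡0 b (ℕ.m+n≡0⇒n≡0 a small))
  where
  small : a + (b + c) ≡ 0
  small = ℕ.n≤0⇒n≡0 (ℕ.+-cancelʳ-≤ 2 (a + (b + c)) 0 (begin
    a + (b + c) + 2
      ≤⟨ ℕ.+-monoʳ-≤ (a + (b + c)) (ℕ.+-mono-≤ {1} {suc d} (s≤s z≤n) (s≤s z≤n)) ⟩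
    a + (b + c) + (suc d + suc d)
      ≡⟨ trans (ℕ.+-assoc a (b + c) _) (cong (a +_) (ℕ.+-assoc b c _)) ⟩
    a + (b + (c + (suc d + suc d)))
      ≤⟨ h ⟩
    2 ∎))
    where open ℕ.≤-Reasoning

-- Arrays with at most two uncovered edges give colourings.

Loopless : Graph → Set
Loopless G = ∀ e → end G e 0F ≢ end G e 1F

⟦⟧≡0⇒false : ∀ {b} → ⟦ b ⟧ ≡ 0 → b ≡ false
⟦⟧≡0⇒false {false} _ = refl

module Arrays {G : Graph} (C : FiniteCubic G) (A : ThreeArray G) where
  open FiniteCubic C
  open Matchings C
  open ThreeArray A

  stat : ∀ {X : Set} → (Bool → Bool → Bool → X) → E G → X
  stat f e = f (M₁ e) (M₂ e) (M₃ e)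

  total : (E G → ℕ) → ℕ
  total f = sum (f ∘ edg)

  count : ℕ
  count = total (⟦_⟧ ∘ stat uncovered)

  uncovered↔count : UncoveredCount G A count
  uncovered↔count = filter enumE (stat uncovered)

  UncoveredCount⇒≡count : ∀ {k} → UncoveredCount G A k → k ≡ count
  UncoveredCount⇒≡count Z = ↔⇒≡ (↔-trans (↔-sym Z) uncovered↔count)

  module _ (w : V G) where
    choice : Fin 3 → Fin 3
    choice 0F = proj₁ (matching⇒perfect pm₁ w)
    choice 1F = proj₁ (matching⇒perfect pm₂ w)
    choice 2F = proj₁ (matching⇒perfect pm₃ w)

    local : ∀ {X : Set} (f : Bool → Bool → Bool → X) t →
      stat f (edge w t) ≡ pattern₃ f (choice 0F) (choice 1F) (choice 2F) t
    local f t
      rewrite proj₂ (matching⇒perfect pm₁ w) t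
            | proj₂ (matching⇒perfect pm₂ w) t
            | proj₂ (matching⇒perfect pm₃ w) t = refl

  twice-without : Fin 3 → ℕ
  twice-without i = total (⟦_⟧ ∘ stat (twiceWithout i))

  thrices : ℕ
  thrices = total (⟦_⟧ ∘ stat thrice)

  -- The multiplicities at a vertex add up to 3, as do three ones; by double counting, twice either
  -- total is three times the number of vertices.
  total-multiplicity : total (stat multiplicity) ≡ total (λ _ → 1)
  total-multiplicity = ℕ.*-cancelˡ-≡ _ _ 2
    (trans (handshake ℕ.+-0-commutativeMonoid (stat multiplicity))
    (trans (sum-cong-≗ (at-vertex ∘ vtx))
      (sym (handshake ℕ.+-0-commutativeMonoid (λ _ → 1)))))
    where
    at-vertex : ∀ w → sum (stat multiplicity ∘ edge w) ≡ 3
    at-vertex w = trans (sum-cong-≗ (local w multiplicity))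
      (multiplicity-sum (choice w 0F) (choice w 1F) (choice w 2F))

  -- Sum of `multiplicity-excess` over all edges, with the number of edges cancelled by
  -- `total-multiplicity`.
  count-excess : count ≡
    twice-without 0F + (twice-without 1F + (twice-without 2F + (thrices + thrices)))
  count-excess = ℕ.+-cancelˡ-≡ (total (λ _ → 1)) _ _
    (trans (cong (_+ count) (sym total-multiplicity))
    (trans (sym (∑-distrib-+ (stat multiplicity ∘ edg) (⟦_⟧ ∘ stat uncovered ∘ edg)))
    (trans (sum-cong-≗ λ k → multiplicity-excess (M₁ (edg k)) (M₂ (edg k)) (M₃ (edg k)))
    (trans (∑-distrib-+ (λ _ → 1) r₀) (cong (total (λ _ → 1) +_)
    (trans (∑-distrib-+ (w 0F) r₁) (cong (twice-without 0F +_)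
    (trans (∑-distrib-+ (w 1F) r₂) (cong (twice-without 1F +_)
    (trans (∑-distrib-+ (w 2F) r₃) (cong (twice-without 2F +_)
      (∑-distrib-+ T T))))))))))))
    where
    w : Fin 3 → Fin nE → ℕ
    w i = ⟦_⟧ ∘ stat (twiceWithout i) ∘ edg
    T : Fin nE → ℕ
    T = ⟦_⟧ ∘ stat thrice ∘ edg
    r₀ r₁ r₂ r₃ : Fin nE → ℕ
    r₃ k = T k + T k
    r₂ k = w 2F k + r₃ k
    r₁ k = w 1F k + r₂ k
    r₀ k = w 0F k + r₁ k

  total≡0⇒false : (z : E G → Bool) → total (⟦_⟧ ∘ z) ≡ 0 → ∀ e → z e ≡ false
  total≡0⇒false z eq e = trans (cong z (sym (Inverse.strictlyInverseʳ enumE e)))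
    (⟦⟧≡0⇒false (sum≡0⇒≡0 (⟦_⟧ ∘ z ∘ edg) eq (Inverse.to enumE e)))

  pattern-absent : (f : Bool → Bool → Bool → Bool) → total (⟦_⟧ ∘ stat f) ≡ 0 →
    ∀ w t → pattern₃ f (choice w 0F) (choice w 1F) (choice w 2F) t ≡ false
  pattern-absent f eq w t = trans (sym (local w f t)) (total≡0⇒false (stat f) eq (edge w t))

  shift-colouring : ∀ i → twice-without i ≡ 0 → thrices ≡ 0 → Colourable3 G
  shift-colouring i W≡0 T≡0 = local⇒colouring (stat (shiftColour i)) λ w {s} {t} eq →
    shiftColour-injective i (choice w 0F) (choice w 1F) (choice w 2F)
      (pattern-absent (twiceWithout i) W≡0 w) (pattern-absent thrice T≡0 w)
      s t (trans (sym (local w (shiftColour i) s)) (trans eq (local w (shiftColour i) t)))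

  loop-free : Loopless G → ∀ w {s t} → edge w s ≡ edge w t → s ≡ t
  loop-free loopless w {s} {t} eq with half w s in p | half w t in q
  ... | e , i | _ , j with refl ← eq | i ≟ j
  ... | yes refl = half-injective w (trans p (sym q))
  ... | no i≢j = ⊥-elim (distinct-ends i j i≢j
        (trans (sym (cong (uncurry (end G)) p))
          (trans (end-half w s) (trans (sym (end-half w t)) (cong (uncurry (end G)) q)))))
    where
    distinct-ends : ∀ i j → i ≢ j → end G e i ≢ end G e j
    distinct-ends 0F 0F i≢j = contradiction refl i≢j
    distinct-ends 0F 1F _ = loopless e
    distinct-ends 1F 0F _ = loopless e ∘ sym
    distinct-ends 1F 1F i≢j = contradiction refl i≢j

  -- The uncovered edges, at most two, receive distinct labels. A collision of colours would then
  -- put one edge at two positions of a vertex, which is a loop.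
  theta-colouring : Loopless G → count ≤ 2 → (∀ i → twice-without i ≡ 0) → Colourable3 G
  theta-colouring loopless count≤2 W≡0 = local⇒colouring colour λ w {s} {t} eq → inj w s t eq
    where
    open Inverse uncovered↔count
    label : E G → Fin 2
    label e with stat uncovered e Bool.≟ true
    ... | yes p = inject≤ (to (e , p)) count≤2
    -- A default: on covered edges `thetaColour` ignores the label.
    ... | no _ = 0F
    label-injective : ∀ e e′ → stat uncovered e ≡ true → stat uncovered e′ ≡ true →
      label e ≡ label e′ → e ≡ e′
    label-injective e e′ p p′ eq with stat uncovered e Bool.≟ true | stat uncovered e′ Bool.≟ true
    ... | yes q | yes q′ = cong proj₁ (trans (sym (strictlyInverseʳ (e , q)))
            (trans (cong from (inject≤-injective count≤2 count≤2 _ _ eq))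
              (strictlyInverseʳ (e′ , q′))))
    ... | no ¬q | _ = contradiction p ¬q
    ... | _ | no ¬q′ = contradiction p′ ¬q′
    colour : E G → Fin 3
    colour e = stat (thetaColour (label e)) e
    inj : ∀ w s t → colour (edge w s) ≡ colour (edge w t) → s ≡ t
    inj w s t eq with thetaColour-collision (choice w 0F) (choice w 1F) (choice w 2F)
      (λ i → pattern-absent (twiceWithout i) (W≡0 i) w)
      s t (label (edge w s)) (label (edge w t))
      (trans (sym (local w (thetaColour _) s)) (trans eq (local w (thetaColour _) t)))
    ... | inj₁ s≡t = s≡t
    ... | inj₂ (p , q , same) = loop-free loopless w (label-injective _ _
            (trans (local w uncovered s) p) (trans (local w uncovered t) q) same)

  few-uncovered⇒colourable : Loopless G → count ≤ 2 → Colourable3 G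
  few-uncovered⇒colourable loopless count≤2
    with excess-cases (twice-without 0F) (twice-without 1F) (twice-without 2F) thrices
           (subst (_≤ 2) count-excess count≤2)
  ... | inj₁ (T≡0 , i , W≡0) = shift-colouring i (trans (sym (tri-η twice-without i)) W≡0) T≡0
  ... | inj₂ (p , q , r) = theta-colouring loopless count≤2 λ { 0F → p ; 1F → q ; 2F → r }

-- Pigeonhole for three colours, and the inflated graph.

abstract
  no-four-colours : ∀ (a b c d : Fin 3) → a ≢ b → a ≢ c → a ≢ d → b ≢ c → b ≢ d → c ≢ d → ⊥
  no-four-colours = from-yes (all? {3} λ a → all? λ b → all? λ c → all? λ d →
    ¬? (a ≟ b) →-dec ¬? (a ≟ c) →-dec ¬? (a ≟ d) →-dec ¬? (b ≟ c) →-dec ¬? (b ≟ d) →-dec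
    ¬? (c ≟ d) →-dec no id)

injective⇒hits : (g : Fin 3 → Fin 3) → (∀ {s t} → g s ≡ g t → s ≡ t) → ∀ i → Σ (Fin 3) λ t → g t ≡ i
injective⇒hits g inj i with any? (λ t → g t ≟ i)
... | yes hit = hit
... | no miss = ⊥-elim (no-four-colours i (g 0F) (g 1F) (g 2F)
        (λ eq → miss (0F , sym eq)) (λ eq → miss (1F , sym eq)) (λ eq → miss (2F , sym eq))
        (λ eq → contradiction (inj eq) λ ()) (λ eq → contradiction (inj eq) λ ())
        (λ eq → contradiction (inj eq) λ ()))

does-true : ∀ {P : Set} (P? : Dec P) → does P? ≡ true → P
does-true (yes p) _ = p

module Inflation (G : Graph) (_≟V_ : DecidableEquality (V G)) (u v : V G) (u≢v : u ≢ v)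
                 (σu : Half G u ↔ Fin 3) (σv : Half G v ↔ Fin 3) (C : FiniteCubic G) where
  open Inflate G _≟V_ u v σu σv public
  open FiniteCubic C

  root : Bool → V G
  root true = u
  root false = v

  σ : ∀ b → Half G (root b) ↔ Fin 3
  σ true = σu
  σ false = σv

  -- The old half-edge that is re-attached to corner `k` of triangle `b`.
  port : Bool → Fin 3 → E G × Fin 2
  port b k = proj₁ (Inverse.from (σ b) k)

  Old : V G → Set
  Old x = x ≢ u × x ≢ v

  root-or-old : ∀ x → (Σ Bool λ b → x ≡ root b) ⊎ Old x
  root-or-old x with x ≟V u | x ≟V v
  ... | yes p | _ = inj₁ (true , p)
  ... | no _ | yes q = inj₁ (false , q)
  ... | no ¬p | no ¬q = inj₂ (¬p , ¬q)

  old≢root : ∀ {x} → Old x → ∀ b → x ≢ root b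
  old≢root (x≢u , x≢v) true = x≢u
  old≢root (x≢u , x≢v) false = x≢v

  -- `place` hands `fu` the proof found by the decision procedure; uniqueness of identity proofs
  -- exchanges it for `p`.
  place-u : ∀ {x} fu fv (p : x ≡ u) → place x fu fv ≡ inj₂ (true , fu p)
  place-u {x} fu fv p with x ≟V u | x ≟V v
  ... | yes q | _ = cong (λ r → inj₂ (true , fu r)) (≡-irrelevant q p)
  ... | no ¬q | _ = contradiction p ¬q

  place-v : ∀ {x} fu fv (p : x ≡ v) → place x fu fv ≡ inj₂ (false , fv p)
  place-v {x} fu fv p with x ≟V u | x ≟V v
  ... | yes q | _ = contradiction (trans (sym q) p) u≢v
  ... | no _ | yes q = cong (λ r → inj₂ (false , fv r)) (≡-irrelevant q p)
  ... | no _ | no ¬q = contradiction p ¬q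

  place-old : ∀ {x} fu fv → Old x →
    Σ (Σ (V G) λ y → False (y ≟V u) × False (y ≟V v)) λ y → proj₁ y ≡ x × place x fu fv ≡ inj₁ y
  place-old {x} fu fv (x≢u , x≢v) with x ≟V u | x ≟V v
  ... | yes q | _ = contradiction q x≢u
  ... | no _ | yes q = contradiction q x≢v
  ... | no _ | no _ = _ , refl , refl

  end-root : ∀ b e i (p : end G e i ≡ root b) →
    end' (inj₁ e) i ≡ inj₂ (b , Inverse.to (σ b) ((e , i) , p))
  end-root true e i p = place-u _ _ p
  end-root false e i p = place-v _ _ p

  end-old : ∀ e i {x} ab → end G e i ≡ x → end' (inj₁ e) i ≡ inj₁ (x , ab)
  end-old e i (a , b) refl with place-old _ _ (toWitnessFalse a , toWitnessFalse b)
  ... | (_ , a′ , b′) , refl , eq = trans eq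
    (cong₂ (λ a b → inj₁ (_ , a , b)) (Bool.T-irrelevant a′ a) (Bool.T-irrelevant b′ b))

  Old′ : V G → Set
  Old′ x = False (x ≟V u) × False (x ≟V v)

  old⇒old′ : ∀ {x} → Old x → Old′ x
  old⇒old′ (x≢u , x≢v) = fromWitnessFalse x≢u , fromWitnessFalse x≢v

  next³ : ∀ k → next (next (next k)) ≡ k
  next³ 0F = refl
  next³ 1F = refl
  next³ 2F = refl

  half′ : V' → Fin 3 → E' × Fin 2
  half′ (inj₁ (x , _)) t = inj₁ (edge x t) , proj₂ (half x t)
  half′ (inj₂ (b , k)) 0F = inj₁ (proj₁ (port b k)) , proj₂ (port b k)
  half′ (inj₂ (b , k)) 1F = inj₂ (b , k) , 0F
  -- The triangle edge that ends at corner `k` has number k - 1 modulo 3, which is `next (next k)`.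
  half′ (inj₂ (b , k)) 2F = inj₂ (b , next (next k)) , 1F

  index′ : E' → Fin 2 → Fin 3
  index′ (inj₁ e) i with root-or-old (end G e i)
  ... | inj₁ _ = 0F
  ... | inj₂ _ = index e i
  index′ (inj₂ _) 0F = 1F
  index′ (inj₂ _) 1F = 2F

  index-root : ∀ b e i → end G e i ≡ root b → index′ (inj₁ e) i ≡ 0F
  index-root b e i p with root-or-old (end G e i)
  ... | inj₁ _ = refl
  ... | inj₂ old = contradiction p (old≢root old b)

  index-old : ∀ e i → Old (end G e i) → index′ (inj₁ e) i ≡ index e i
  index-old e i old with root-or-old (end G e i)
  ... | inj₁ (b , p) = contradiction p (old≢root old b)
  ... | inj₂ _ = refl

  end-half′ : ∀ w t → uncurry end' (half′ w t) ≡ w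
  end-half′ (inj₁ (x , ab)) t = end-old (edge x t) (proj₂ (half x t)) ab (end-half x t)
  end-half′ (inj₂ (b , k)) 0F = trans
    (end-root b (proj₁ (port b k)) (proj₂ (port b k)) (proj₂ (Inverse.from (σ b) k)))
    (cong (λ j → inj₂ (b , j)) (Inverse.strictlyInverseˡ (σ b) k))
  end-half′ (inj₂ (b , k)) 1F = refl
  end-half′ (inj₂ (b , k)) 2F = cong (λ j → inj₂ (b , j)) (next³ k)

  half-index′ : ∀ e i → half′ (end' e i) (index′ e i) ≡ (e , i)
  half-index′ (inj₁ e) i with root-or-old (end G e i)
  ... | inj₁ (b , p) = trans (cong (λ w → half′ w 0F) (end-root b e i p))
          (cong (λ h → inj₁ (proj₁ (proj₁ h)) , proj₂ (proj₁ h))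
            (Inverse.strictlyInverseʳ (σ b) ((e , i) , p)))
  ... | inj₂ old = trans
          (cong (λ w → half′ w (index e i)) (end-old e i (old⇒old′ old) refl))
          (cong (λ (f , j) → inj₁ f , j) (half-index e i))
  half-index′ (inj₂ (b , k)) 0F = refl
  half-index′ (inj₂ (b , k)) 1F = cong (λ j → inj₂ (b , j) , 1F) (next³ k)

  index-half′ : ∀ w t → uncurry index′ (half′ w t) ≡ t
  index-half′ (inj₁ (x , a , b)) t = trans
    (index-old (edge x t) (proj₂ (half x t))
      (subst Old (sym (end-half x t)) (toWitnessFalse a , toWitnessFalse b)))
    (index-half x t)
  index-half′ (inj₂ (b , k)) 0F = index-root b _ _ (proj₂ (Inverse.from (σ b) k))
  index-half′ (inj₂ (b , k)) 1F = refl
  index-half′ (inj₂ (b , k)) 2F = refl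

  old? : ∀ x → Dec (Old x)
  old? x = ¬? (x ≟V u) ×-dec ¬? (x ≟V v)

  old↔ : (Σ (V G) λ x → False (x ≟V u) × False (x ≟V v)) ↔ (Σ (V G) λ x → does (old? x) ≡ true)
  old↔ = mk↔ₛ′
    (λ (x , a , b) → x , dec-true (old? x) (toWitnessFalse a , toWitnessFalse b))
    (λ (x , p) → x , old⇒old′ (does-true (old? x) p))
    (λ (x , p) → cong (x ,_) (true-prop _ p))
    (λ (x , a , b) → cong₂ (λ a b → x , a , b) (Bool.T-irrelevant _ a) (Bool.T-irrelevant _ b))

  triangles : (Bool × Fin 3) ↔ Fin 6
  triangles = ↔-trans (↔-sym 2↔Bool ×-↔ ↔-refl) (↔-sym (*↔× {2} {3}))

  inflated : FiniteCubic graph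
  inflated = record
    { enumV = ↔-trans (↔-trans old↔ (filter enumV (does ∘ old?)) ⊎-↔ triangles) (↔-sym +↔⊎)
    ; enumE = ↔-trans (enumE ⊎-↔ triangles) (↔-sym +↔⊎)
    ; half = half′
    ; index = index′
    ; end-half = end-half′
    ; half-index = half-index′
    ; index-half = index-half′
    }

  port-injective : ∀ b {h h′ : Half G (root b)} → Inverse.to (σ b) h ≡ Inverse.to (σ b) h′ → h ≡ h′
  port-injective b {h} {h′} eq = trans (sym (Inverse.strictlyInverseʳ (σ b) h))
    (trans (cong (Inverse.from (σ b)) eq) (Inverse.strictlyInverseʳ (σ b) h′))

  inj₁-old : ∀ {x y ab cd} → _≡_ {A = V'} (inj₁ (x , ab)) (inj₁ (y , cd)) → x ≡ y
  inj₁-old refl = refl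

  -- The two halves of a loop at `u` or `v` go to different corners. A loop at any other vertex
  -- would contradict the colouring of the graph without `u` and `v`.
  inflated-loopless : Colourable3On G Old → Loopless graph
  inflated-loopless _ (inj₂ (b , 0F)) ()
  inflated-loopless _ (inj₂ (b , 1F)) ()
  inflated-loopless _ (inj₂ (b , 2F)) ()
  inflated-loopless (c , proper) (inj₁ e) eq
    with root-or-old (end G e 0F) | root-or-old (end G e 1F)
  ... | inj₁ (b , p) | inj₁ (b′ , p′) = roots b b′ p p′
          (trans (sym (end-root b e 0F p)) (trans eq (end-root b′ e 1F p′)))
    where
    roots : ∀ b b′ (p : end G e 0F ≡ root b) (p′ : end G e 1F ≡ root b′) →
      _≡_ {A = V'} (inj₂ (b , Inverse.to (σ b) ((e , 0F) , p)))
                   (inj₂ (b′ , Inverse.to (σ b′) ((e , 1F) , p′))) → ⊥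
    roots b b′ p p′ q with inj₂-injective q
    ... | q′ with refl ← cong proj₁ q′ = contradiction
      (cong (proj₂ ∘ proj₁) (port-injective b {(e , 0F) , p} {(e , 1F) , p′} (cong proj₂ q′))) λ ()
  ... | inj₁ (b , p) | inj₂ old = contradiction
          (trans (sym (end-root b e 0F p)) (trans eq (end-old e 1F (old⇒old′ old) refl))) λ ()
  ... | inj₂ old | inj₁ (b , p) = contradiction
          (trans (sym (end-root b e 1F p)) (trans (sym eq) (end-old e 0F (old⇒old′ old) refl))) λ ()
  ... | inj₂ old | inj₂ old′ = proper e 0F e 1F in-old in-old
          (inj₁-old (trans (sym (end-old e 0F (old⇒old′ old) refl))
            (trans eq (end-old e 1F (old⇒old′ old′) refl)))) (λ ()) refl
    where
    in-old : InP G Old e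
    in-old 0F = old
    in-old 1F = old′

  abstract
    -- The triangle edges at corner `k` are `k` and `next (next k)`, and any two corners of a
    -- triangle meet all its edges.
    triangle-cover : ∀ k l j → k ≢ l → j ≡ k ⊎ j ≡ next (next k) ⊎ j ≡ l ⊎ j ≡ next (next l)
    triangle-cover = from-yes (all? λ k → all? λ l → all? λ j → ¬? (k ≟ l) →-dec
      ((j ≟ k) ⊎-dec ((j ≟ next (next k)) ⊎-dec ((j ≟ l) ⊎-dec (j ≟ next (next l))))))

  -- The three triangle edges use all colours, and an edge leaving the triangle avoids the
  -- colours of two of them; so two leaving edges of the same colour would avoid all three.
  contract-colouring : Colourable3 graph → Colourable3 G
  contract-colouring (c , proper) = c ∘ inj₁ , good
    where
    good : Colouring3On G _ (c ∘ inj₁)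
    good e i e′ i′ _ _ same h≢h′ with root-or-old (end G e i)
    ... | inj₂ old = proper (inj₁ e) i (inj₁ e′) i′ _ _
            (trans (end-old e i ab refl) (sym (end-old e′ i′ ab (sym same))))
            λ { refl → h≢h′ refl }
      where ab = old⇒old′ old
    ... | inj₁ (b , p) = λ eq → no-four-colours (c (inj₁ e)) (τ 0F) (τ 1F) (τ 2F)
            (avoid eq 0F) (avoid eq 1F) (avoid eq 2F) (τ≢ 0F)
            (λ q → τ≢ 2F (sym q)) (τ≢ 1F)
      where
      τ : Fin 3 → Fin 3
      τ j = c (inj₂ (b , j))
      p′ = trans (sym same) p
      k = Inverse.to (σ b) ((e , i) , p)
      l = Inverse.to (σ b) ((e′ , i′) , p′)
      k≢l : k ≢ l
      k≢l eq = h≢h′ (cong proj₁ (port-injective b {(e , i) , p} {(e′ , i′) , p′} eq))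
      τ≢ : ∀ j → τ j ≢ τ (next j)
      τ≢ j = proper (inj₂ (b , j)) 1F (inj₂ (b , next j)) 0F _ _ refl λ ()
      leave : ∀ f a (q : end G f a ≡ root b) j (m : Fin 2) →
        end' (inj₂ (b , j)) m ≡ inj₂ (b , Inverse.to (σ b) ((f , a) , q)) → c (inj₁ f) ≢ τ j
      leave f a q j m r =
        proper (inj₁ f) a (inj₂ (b , j)) m _ _ (trans (end-root b f a q) (sym r)) λ ()
      avoid : c (inj₁ e) ≡ c (inj₁ e′) → ∀ j → c (inj₁ e) ≢ τ j
      avoid eq j with triangle-cover k l j k≢l
      ... | inj₁ refl = leave e i p j 0F refl
      ... | inj₂ (inj₁ refl) = leave e i p j 1F (cong (λ x → inj₂ (b , x)) (next³ k))
      ... | inj₂ (inj₂ (inj₁ refl)) = leave e′ i′ p′ j 0F refl ∘ trans (sym eq)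
      ... | inj₂ (inj₂ (inj₂ refl)) =
        leave e′ i′ p′ j 1F (cong (λ x → inj₂ (b , x)) (next³ l)) ∘ trans (sym eq)

-- Extension of partial colourings.

distinct⇒injective : (g : Fin 3 → Fin 3) → g 0F ≢ g 1F → g 0F ≢ g 2F → g 1F ≢ g 2F →
  ∀ {s t} → g s ≡ g t → s ≡ t
distinct⇒injective g a b c {0F} {0F} _ = refl
distinct⇒injective g a b c {0F} {1F} eq = contradiction eq a
distinct⇒injective g a b c {0F} {2F} eq = contradiction eq b
distinct⇒injective g a b c {1F} {0F} eq = contradiction (sym eq) a
distinct⇒injective g a b c {1F} {1F} _ = refl
distinct⇒injective g a b c {1F} {2F} eq = contradiction eq c
distinct⇒injective g a b c {2F} {0F} eq = contradiction (sym eq) b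
distinct⇒injective g a b c {2F} {1F} eq = contradiction (sym eq) c
distinct⇒injective g a b c {2F} {2F} _ = refl

InjectiveOn : (Fin 3 → Bool) → (Fin 3 → Fin 3) → Set
InjectiveOn d f = ∀ s t → d s ≡ true → d t ≡ true → f s ≡ f t → s ≡ t

Completes : (Fin 3 → Bool) → (Fin 3 → Fin 3) → (Fin 3 → Fin 3) → Set
Completes d f g = (∀ s t → g s ≡ g t → s ≡ t) × (∀ s → d s ≡ true → g s ≡ f s)

-- Quantifying over values instead of functions makes the statement decidable by enumeration.
Completable : Bool → Bool → Bool → Set
Completable p q r = ∀ x y z → InjectiveOn (tri p q r) (tri x y z) →
  Σ (Fin 3) λ x′ → Σ (Fin 3) λ y′ → Σ (Fin 3) λ z′ →
  Completes (tri p q r) (tri x y z) (tri x′ y′ z′)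

completable? : ∀ p q r → Dec (Completable p q r)
completable? p q r = all? λ x → all? λ y → all? λ z →
  (all? λ s → all? λ t → (tri p q r s Bool.≟ true) →-dec (tri p q r t Bool.≟ true) →-dec
    (tri x y z s ≟ tri x y z t) →-dec (s ≟ t)) →-dec
  (any? λ x′ → any? λ y′ → any? λ z′ →
    (all? λ s → all? λ t → (tri x′ y′ z′ s ≟ tri x′ y′ z′ t) →-dec (s ≟ t)) ×-dec
    (all? λ s → (tri p q r s Bool.≟ true) →-dec (tri x′ y′ z′ s ≟ tri x y z s)))

abstract
  completable : ∀ p q r → Completable p q r
  completable true true true = from-yes (completable? true true true)
  completable true true false = from-yes (completable? true true false)
  completable true false true = from-yes (completable? true false true)
  completable true false false = from-yes (completable? true false false)
  completable false true true = from-yes (completable? false true true)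
  completable false true false = from-yes (completable? false true false)
  completable false false true = from-yes (completable? false false true)
  completable false false false = from-yes (completable? false false false)

-- A partial injection leaves as many colours as positions, so it extends to a permutation.
complete : ∀ d f → InjectiveOn d f → Σ (Fin 3 → Fin 3) (Completes d f)
complete d f inj with completable (d 0F) (d 1F) (d 2F) (f 0F) (f 1F) (f 2F)
  (λ s t p q eq → inj s t (trans (sym (tri-η d s)) p) (trans (sym (tri-η d t)) q)
    (trans (sym (tri-η f s)) (trans eq (tri-η f t))))
... | x , y , z , g-inj , g-ext =
  tri x y z , g-inj , λ s p → trans (g-ext s (trans (tri-η d s) p)) (tri-η f s)

module Extension {G : Graph} (C : FiniteCubic G) (P : V G → Set) (P? : ∀ x → Dec (P x))
                 (c : E G → Fin 3) (proper : Colouring3On G P c) where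
  open FiniteCubic C

  abstract
    inP? : ∀ e → Dec (InP G P e)
    inP? e = all? (λ i → P? (end G e i))

  completion : ∀ w → Σ (Fin 3 → Fin 3) (Completes (λ t → does (inP? (edge w t))) (c ∘ edge w))
  completion w = complete _ _ inj
    where
    inj : InjectiveOn (λ t → does (inP? (edge w t))) (c ∘ edge w)
    inj s t p q eq with s ≟ t
    ... | yes s≡t = s≡t
    ... | no s≢t = contradiction eq
          (proper (edge w s) (proj₂ (half w s)) (edge w t) (proj₂ (half w t))
            (does-true (inP? (edge w s)) p) (does-true (inP? (edge w t)) q)
            (trans (end-half w s) (sym (end-half w t))) (s≢t ∘ half-injective w))

  -- Completions at different vertices do not conflict, because an edge that fails `InP` has at most
  -- one end in `P`. If it has none, like the edge between `u` and `v`, its colour is arbitrary.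
  extended : E G → Fin 3
  extended e with inP? e | P? (end G e 0F)
  ... | yes _ | _ = c e
  ... | no _ | yes _ = proj₁ (completion (end G e 0F)) (index e 0F)
  ... | no _ | no _ = proj₁ (completion (end G e 1F)) (index e 1F)

  extended-at : ∀ e i → P (end G e i) → extended e ≡ proj₁ (completion (end G e i)) (index e i)
  extended-at e i Pi with inP? e in eq | P? (end G e 0F)
  ... | yes _ | _ = sym (trans (proj₂ (proj₂ (completion (end G e i))) (index e i)
          (trans (cong (does ∘ inP? ∘ proj₁) (half-index e i)) (cong does eq)))
        (cong (c ∘ proj₁) (half-index e i)))
  extended-at e 0F Pi | no _ | yes _ = refl
  extended-at e 1F Pi | no ¬in | yes P0 = contradiction (λ { 0F → P0 ; 1F → Pi }) ¬in
  extended-at e 0F Pi | no _ | no ¬P0 = contradiction Pi ¬P0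
  extended-at e 1F Pi | no _ | no _ = refl

  extended-injective : ∀ w → P w → ∀ {s t} → extended (edge w s) ≡ extended (edge w t) → s ≡ t
  extended-injective w Pw {s} {t} eq =
    proj₁ (proj₂ (completion w)) s t (trans (sym (at s)) (trans eq (at t)))
    where
    at : ∀ t → extended (edge w t) ≡ proj₁ (completion w) t
    at t = trans (extended-at (edge w t) (proj₂ (half w t)) (subst P (sym (end-half w t)) Pw))
      (cong₂ (λ x → proj₁ (completion x)) (end-half w t) (index-half w t))

-- The parity lemma.

Balanced : (Fin 3 → Bool) → Set
Balanced F = ∀ x y z → x ≢ y → x ≢ z → y ≢ z → F x xor (F y xor (F z xor false)) ≡ false

-- The two coordinates of the colours 0, 1, 2 viewed as the nonzero elements (1,0), (1,1), (0,1) of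
-- the Klein four-group, whose sum is zero.
F₀₁ F₁₂ : Fin 3 → Bool
F₀₁ = tri true true false
F₁₂ = tri false true true

balanced? : ∀ F → Dec (Balanced F)
balanced? F = all? λ x → all? λ y → all? λ z → ¬? (x ≟ y) →-dec ¬? (x ≟ z) →-dec ¬? (y ≟ z) →-dec
  (F x xor (F y xor (F z xor false)) Bool.≟ false)

abstract
  F₀₁-balanced : Balanced F₀₁
  F₀₁-balanced = from-yes (balanced? F₀₁)

  F₁₂-balanced : Balanced F₁₂
  F₁₂-balanced = from-yes (balanced? F₁₂)

  -- The hypotheses say p + p′ = q + q′ in the Klein four-group. If this sum is zero, both pairs are
  -- equal; otherwise it is the colour `r` missing from both pairs.
  four-colours-parity : ∀ p p′ q q′ →
    (F₀₁ p xor F₀₁ p′) xor (F₀₁ q xor F₀₁ q′) ≡ false →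
    (F₁₂ p xor F₁₂ p′) xor (F₁₂ q xor F₁₂ q′) ≡ false →
    (p ≡ p′ × q ≡ q′) ⊎
    (p ≢ p′ × q ≢ q′ × Σ (Fin 3) λ r → (r ≢ p × r ≢ p′) × (r ≢ q × r ≢ q′))
  four-colours-parity = from-yes (all? λ p → all? λ p′ → all? λ q → all? λ q′ →
    ((F₀₁ p xor F₀₁ p′) xor (F₀₁ q xor F₀₁ q′) Bool.≟ false) →-dec
    ((F₁₂ p xor F₁₂ p′) xor (F₁₂ q xor F₁₂ q′) Bool.≟ false) →-dec
    (((p ≟ p′) ×-dec (q ≟ q′)) ⊎-dec
     (¬? (p ≟ p′) ×-dec (¬? (q ≟ q′) ×-dec any? λ r →
       (¬? (r ≟ p) ×-dec ¬? (r ≟ p′)) ×-dec (¬? (r ≟ q) ×-dec ¬? (r ≟ q′))))))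

module Parity {G : Graph} (C : FiniteCubic G) (u v : V G) (u≢v : u ≢ v) (c : E G → Fin 3)
  (inj : ∀ w → w ≢ u × w ≢ v → ∀ {s t} →
         c (FiniteCubic.edge C w s) ≡ c (FiniteCubic.edge C w t) → s ≡ t) where
  open FiniteCubic C

  vertexSum : (Fin 3 → Bool) → V G → Bool
  vertexSum F w = xorSum (F ∘ c ∘ edge w)

  -- All other vertices see three distinct colours and contribute 0, while every edge is counted at
  -- both its ends, so that the total vanishes modulo 2.
  parity : ∀ F → Balanced F → vertexSum F u xor vertexSum F v ≡ false
  parity F balanced = trans
    (sym (cong₂ (λ x y → vertexSum F x xor vertexSum F y) (strictlyInverseʳ u) (strictlyInverseʳ v)))
    (trans (sym (sum-pair xorMonoid (vertexSum F ∘ vtx) (to u) (to v) to-u≢to-v off))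
      (trans (sym (handshake xorMonoid (F ∘ c))) (cancel (xorSum (F ∘ c ∘ edg)))))
    where
    open Inverse enumV
    cancel : ∀ x → x xor (x xor false) ≡ false
    cancel true = refl
    cancel false = refl
    to-u≢to-v : to u ≢ to v
    to-u≢to-v eq = u≢v
      (trans (sym (strictlyInverseʳ u)) (trans (cong from eq) (strictlyInverseʳ v)))
    apart : ∀ {k} x → k ≢ to x → vtx k ≢ x
    apart {k} x k≢ eq = k≢ (trans (sym (strictlyInverseˡ k)) (cong to eq))
    off : ∀ k → k ≢ to u → k ≢ to v → vertexSum F (vtx k) ≡ false
    off k k≢u k≢v = balanced _ _ _ (λ eq → contradiction (inj′ eq) λ ())
      (λ eq → contradiction (inj′ eq) λ ()) (λ eq → contradiction (inj′ eq) λ ())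
      where
      inj′ : ∀ {s t} → c (edge (vtx k) s) ≡ c (edge (vtx k) t) → s ≡ t
      inj′ = inj (vtx k) (apart u k≢u , apart v k≢v)

-- The upper bound: an array with at most four uncovered edges.

ExactlyOne-cong : ∀ {a b} → (∀ t → a t ≡ b t) → ExactlyOne b → ExactlyOne a
ExactlyOne-cong a≗b (t₀ , value) = t₀ , λ t → trans (a≗b t) (value t)

xor-cancel : ∀ x y z → (x xor y) xor (x xor z) ≡ y xor z
xor-cancel true true true = refl
xor-cancel true true false = refl
xor-cancel true false true = refl
xor-cancel true false false = refl
xor-cancel false y z = refl

xorSum₃ : ∀ x y z → (x xor (y xor (z xor false)) ≡ x xor (y xor z))
  × (x xor (y xor (z xor false)) ≡ y xor (z xor x))
  × (x xor (y xor (z xor false)) ≡ z xor (x xor y))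
xorSum₃ true true true = refl , refl , refl
xorSum₃ true true false = refl , refl , refl
xorSum₃ true false true = refl , refl , refl
xorSum₃ true false false = refl , refl , refl
xorSum₃ false true true = refl , refl , refl
xorSum₃ false true false = refl , refl , refl
xorSum₃ false false true = refl , refl , refl
xorSum₃ false false false = refl , refl , refl

two-values : ∀ {i a b : Fin 2} → a ≢ b → i ≡ a ⊎ i ≡ b
two-values {0F} {0F} _ = inj₁ refl
two-values {0F} {1F} {0F} _ = inj₂ refl
two-values {0F} {1F} {1F} a≢b = contradiction refl a≢b
two-values {1F} {1F} _ = inj₁ refl
two-values {1F} {0F} {1F} _ = inj₂ refl
two-values {1F} {0F} {0F} a≢b = contradiction refl a≢b

uncovered⇒false : (f : Fin 3 → Bool) → uncovered (f 0F) (f 1F) (f 2F) ≡ true →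
  (i : Fin 3) → f i ≡ false
uncovered⇒false f eq i with f 0F in p | f 1F in q | f 2F in r
uncovered⇒false f eq 0F | false | false | false = p
uncovered⇒false f eq 1F | false | false | false = q
uncovered⇒false f eq 2F | false | false | false = r

-- `e₀` is the edge between `u` and `v`, and `j b` its end at `root b`. By `half-root`, positions at
-- `u` and `v` agree with corners of the triangles.
module Upper (G : Graph) (_≟V_ : DecidableEquality (V G)) (u v : V G) (u≢v : u ≢ v)
             (σu : Half G u ↔ Fin 3) (σv : Half G v ↔ Fin 3) (C : FiniteCubic G)
             (half-root : ∀ b k → FiniteCubic.half C (Inflation.root G _≟V_ u v u≢v σu σv C b) k
                                ≡ Inflation.port G _≟V_ u v u≢v σu σv C b k)
             (uncolourable : ¬ Colourable3 G)
             (nonremovable : Colourable3On G (Inflation.Old G _≟V_ u v u≢v σu σv C))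
             (e₀ : E G) (j : Bool → Fin 2)
             (ends : ∀ b → end G e₀ (j b) ≡ Inflation.root G _≟V_ u v u≢v σu σv C b) where
  open Inflation G _≟V_ u v u≢v σu σv C
  open FiniteCubic C
  open Matchings
  open Extension C Old old? (proj₁ nonremovable) (proj₂ nonremovable)
    renaming (extended to c; extended-injective to c-injective)

  _≟E_ : DecidableEquality (E G)
  _≟E_ = via-injection (↔⇒↣ enumE) _≟_

  root-injective : ∀ b b′ → root b ≡ root b′ → b ≡ b′
  root-injective true true _ = refl
  root-injective true false eq = contradiction eq u≢v
  root-injective false true eq = contradiction (sym eq) u≢v
  root-injective false false _ = refl

  end-e₀ : ∀ i → Σ Bool λ b → i ≡ j b
  end-e₀ i with two-values {i} {j true} {j false}
    (λ eq → u≢v (trans (sym (ends true)) (trans (cong (end G e₀) eq) (ends false))))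
  ... | inj₁ p = true , p
  ... | inj₂ p = false , p

  -- The corner of triangle `b` to which `e₀` is attached.
  spoke : Bool → Fin 3
  spoke b = Inverse.to (σ b) ((e₀ , j b) , ends b)

  port-spoke : ∀ b → port b (spoke b) ≡ (e₀ , j b)
  port-spoke b = cong proj₁ (Inverse.strictlyInverseʳ (σ b) ((e₀ , j b) , ends b))

  end-port : ∀ b k → uncurry (end G) (port b k) ≡ root b
  end-port b k = proj₂ (Inverse.from (σ b) k)

  -- The ends of `e₀` are different vertices, so it takes only one position at `root b`.
  port≡e₀ : ∀ b k → proj₁ (port b k) ≡ e₀ → k ≡ spoke b
  port≡e₀ b k eq with end-e₀ (proj₂ (port b k))
  ... | b′ , p with refl ← root-injective b′ b
        (trans (sym (ends b′)) (trans (sym (cong₂ (end G) eq p)) (end-port b k))) =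
    half-injective (root b) (trans (half-root b k) (trans (cong₂ _,_ eq p)
      (sym (trans (half-root b (spoke b)) (port-spoke b)))))

  edge-old≢e₀ : ∀ {x} → Old x → ∀ t → edge x t ≢ e₀
  edge-old≢e₀ {x} old t eq with end-e₀ (proj₂ (half x t))
  ... | b , p = old≢root old b (trans (sym (end-half x t)) (trans (cong₂ (end G) eq p) (ends b)))

  next≢ : ∀ k → next k ≢ k
  next≢ 0F ()
  next≢ 1F ()
  next≢ 2F ()

  next²≢ : ∀ k → next (next k) ≢ k
  next²≢ 0F ()
  next²≢ 1F ()
  next²≢ 2F ()

  portColour : Bool → Fin 3 → Fin 3
  portColour b k = c (proj₁ (port b k))

  xorSum-rotate : (h : Fin 3 → Bool) → ∀ k → xorSum h ≡ h k xor (h (next k) xor h (next (next k)))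
  xorSum-rotate h 0F = proj₁ (xorSum₃ (h 0F) (h 1F) (h 2F))
  xorSum-rotate h 1F = proj₁ (proj₂ (xorSum₃ (h 0F) (h 1F) (h 2F)))
  xorSum-rotate h 2F = proj₂ (proj₂ (xorSum₃ (h 0F) (h 1F) (h 2F)))

  injective-rotate : (g : Fin 3 → Fin 3) → ∀ k → g k ≢ g (next k) → g k ≢ g (next (next k)) →
    g (next k) ≢ g (next (next k)) → ∀ {s t} → g s ≡ g t → s ≡ t
  injective-rotate g 0F a b c = distinct⇒injective g a b c
  injective-rotate g 1F a b c = distinct⇒injective g (b ∘ sym) (c ∘ sym) a
  injective-rotate g 2F a b c = distinct⇒injective g c (a ∘ sym) (b ∘ sym)

  open Parity C u v u≢v c c-injective

  outer : (Fin 3 → Bool) → Bool → Bool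
  outer F b = F (portColour b (next (spoke b))) xor F (portColour b (next (next (spoke b))))

  vertexSum-root : ∀ F b → vertexSum F (root b) ≡ F (c e₀) xor outer F b
  vertexSum-root F b = trans (xorSum-rotate (F ∘ c ∘ edge (root b)) (spoke b))
    (cong₂ _xor_ (trans (at (spoke b)) (cong (F ∘ c ∘ proj₁) (port-spoke b)))
      (cong₂ _xor_ (at (next (spoke b))) (at (next (next (spoke b))))))
    where
    at : ∀ k → F (c (edge (root b) k)) ≡ F (portColour b k)
    at k = cong (F ∘ c ∘ proj₁) (half-root b k)

  -- The arbitrary colour of `e₀` contributes once at `u` and once at `v`, hence cancels.
  outer-parity : ∀ F → Balanced F → outer F true xor outer F false ≡ false
  outer-parity F balanced = trans (sym (xor-cancel (F (c e₀)) (outer F true) (outer F false)))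
    (trans (sym (cong₂ _xor_ (vertexSum-root F true) (vertexSum-root F false))) (parity F balanced))

  -- If the two remaining colours at u differ, then so do those at v and they are the same two
  -- colours, so that e₀ can take the third colour.
  outer-equal : ∀ b → portColour b (next (spoke b)) ≡ portColour b (next (next (spoke b)))
  outer-equal
    with four-colours-parity _ _ _ _
           (outer-parity F₀₁ F₀₁-balanced) (outer-parity F₁₂ F₁₂-balanced)
  ... | inj₁ (p , q) = λ { true → p ; false → q }
  ... | inj₂ (p≢ , q≢ , r , r≢u , r≢v) =
          ⊥-elim (uncolourable (local⇒colouring C recolour injective))
    where
    recolour : E G → Fin 3
    recolour f with f ≟E e₀
    ... | yes _ = r
    ... | no _ = c f
    recolour-e₀ : recolour e₀ ≡ r
    recolour-e₀ with e₀ ≟E e₀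
    ... | yes _ = refl
    ... | no ≢ = contradiction refl ≢
    recolour-other : ∀ {f} → f ≢ e₀ → recolour f ≡ c f
    recolour-other {f} f≢ with f ≟E e₀
    ... | yes eq = contradiction eq f≢
    ... | no _ = refl
    outer≢ : ∀ b → portColour b (next (spoke b)) ≢ portColour b (next (next (spoke b)))
    outer≢ true = p≢
    outer≢ false = q≢
    r≢ : ∀ b → r ≢ portColour b (next (spoke b)) × r ≢ portColour b (next (next (spoke b)))
    r≢ true = r≢u
    r≢ false = r≢v
    at-root : ∀ b {s t} → recolour (edge (root b) s) ≡ recolour (edge (root b) t) → s ≡ t
    at-root b {s} {t} eq = injective-rotate (recolour ∘ proj₁ ∘ port b) k
      (λ q → proj₁ (r≢ b) (trans (sym at₀) (trans q at₁)))
      (λ q → proj₂ (r≢ b) (trans (sym at₀) (trans q at₂)))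
      (λ q → outer≢ b (trans (sym at₁) (trans q at₂)))
      (trans (sym (cong (recolour ∘ proj₁) (half-root b s)))
        (trans eq (cong (recolour ∘ proj₁) (half-root b t))))
      where
      k = spoke b
      at₀ : recolour (proj₁ (port b k)) ≡ r
      at₀ = trans (cong (recolour ∘ proj₁) (port-spoke b)) recolour-e₀
      at₁ : recolour (proj₁ (port b (next k))) ≡ portColour b (next k)
      at₁ = recolour-other (next≢ k ∘ port≡e₀ b (next k))
      at₂ : recolour (proj₁ (port b (next (next k)))) ≡ portColour b (next (next k))
      at₂ = recolour-other (next²≢ k ∘ port≡e₀ b (next (next k)))
    injective : ∀ w {s t} → recolour (edge w s) ≡ recolour (edge w t) → s ≡ t
    injective w {s} {t} eq with root-or-old w
    ... | inj₁ (b , refl) = at-root b eq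
    ... | inj₂ old = c-injective w old
            (trans (sym (recolour-other (edge-old≢e₀ old s)))
              (trans eq (recolour-other (edge-old≢e₀ old t))))

  outerColour : Bool → Fin 3
  outerColour b = portColour b (next (spoke b))

  portColour-outer : ∀ b k → k ≢ spoke b → portColour b k ≡ outerColour b
  portColour-outer b k k≢ with third k (spoke b)
    where
    third : ∀ k l → k ≡ l ⊎ k ≡ next l ⊎ k ≡ next (next l)
    third = from-yes (all? λ k → all? λ l → (k ≟ l) ⊎-dec ((k ≟ next l) ⊎-dec (k ≟ next (next l))))
  ... | inj₁ eq = contradiction eq k≢
  ... | inj₂ (inj₁ eq) = cong (portColour b) eq
  ... | inj₂ (inj₂ eq) = trans (cong (portColour b) eq) (sym (outer-equal b))

  -- Colour class i, together with e₀ and, at each triangle that it does not enter otherwise,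
  -- the triangle edge opposite to e₀.
  matching : Fin 3 → E' → Bool
  matching i (inj₁ f) = does (f ≟E e₀) ∨ does (c f ≟ i)
  matching i (inj₂ (b , k)) = does (k ≟ next (spoke b)) ∧ not (does (outerColour b ≟ i))

  -- The view from corner `k`, where `l` is the corner of `e₀` and `q` tells whether the colour
  -- class enters the triangle by its two other outer edges.
  TrianglePattern : Fin 3 → Fin 3 → Bool → Fin 3 → Bool
  TrianglePattern l k q = 
    tri (does (k ≟ l) ∨ q) (does (k ≟ next l) ∧ not q) (does (next (next k) ≟ next l) ∧ not q)

  abstract
    -- If `q` holds, every corner is matched by its outer edge. Otherwise `e₀` matches `l`, and
    -- triangle edge `next l` joins the other two corners.
    triangle-exact : ∀ q l k → ExactlyOne (TrianglePattern l k q)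
    triangle-exact true = from-yes (all? λ l → all? λ k → any? λ t₀ → all? λ t →
      TrianglePattern l k true t Bool.≟ does (t ≟ t₀))
    triangle-exact false = from-yes (all? λ l → all? λ k → any? λ t₀ → all? λ t →
      TrianglePattern l k false t Bool.≟ does (t ≟ t₀))

  matching-perfect : ∀ i → Perfect inflated (matching i)
  matching-perfect i (inj₁ (x , a , b))
    with injective⇒hits (c ∘ edge x) (c-injective x (toWitnessFalse a , toWitnessFalse b)) i
  ... | t₀ , hit = t₀ , value
    where
    old : Old x
    old = toWitnessFalse a , toWitnessFalse b
    value : ∀ t → matching i (inj₁ (edge x t)) ≡ does (t ≟ t₀)
    value t rewrite dec-false (edge x t ≟E e₀) (edge-old≢e₀ old t) with t ≟ t₀
    ... | yes refl = dec-true (c (edge x t) ≟ i) hit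
    ... | no t≢ = dec-false (c (edge x t) ≟ i) λ eq → t≢ (c-injective x old (trans eq (sym hit)))
  matching-perfect i (inj₂ (b , k)) = ExactlyOne-cong same
    (triangle-exact (does (outerColour b ≟ i)) (spoke b) k)
    where
    same : ∀ t → matching i (FiniteCubic.edge inflated (inj₂ (b , k)) t)
               ≡ TrianglePattern (spoke b) k (does (outerColour b ≟ i)) t
    same 1F = refl
    same 2F = refl
    same 0F with k ≟ spoke b
    ... | yes refl = cong (_∨ does (portColour b (spoke b) ≟ i))
                       (dec-true (_ ≟E e₀) (cong proj₁ (port-spoke b)))
    ... | no k≢ = cong₂ _∨_ (dec-false (_ ≟E e₀) (k≢ ∘ port≡e₀ b k))
                            (cong (λ x → does (x ≟ i)) (portColour-outer b k k≢))

  array : ThreeArray graph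
  array = record
    { M₁ = matching 0F ; M₂ = matching 1F ; M₃ = matching 2F
    ; pm₁ = perfect⇒matching inflated (matching-perfect 0F)
    ; pm₂ = perfect⇒matching inflated (matching-perfect 1F)
    ; pm₃ = perfect⇒matching inflated (matching-perfect 2F)
    }

  open Arrays inflated array

  uncovered⇒unmatched : ∀ e → stat uncovered e ≡ true → ∀ i → matching i e ≡ false
  uncovered⇒unmatched e = uncovered⇒false (λ i → matching i e)

  old-covered : ∀ f → stat uncovered (inj₁ f) ≢ true
  old-covered f z with uncovered⇒unmatched (inj₁ f) z (c f)
  ... | eq rewrite dec-true (c f ≟ c f) refl | Bool.∨-zeroʳ (does (f ≟E e₀)) with () ← eq

  opposite-covered : ∀ b k → stat uncovered (inj₂ (b , k)) ≡ true → k ≢ next (spoke b)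
  -- The edge opposite to `e₀` lies in the matching of every colour other than `outerColour b`;
  -- `next` provides one.
  opposite-covered b k z refl with uncovered⇒unmatched (inj₂ (b , k)) z (next (outerColour b))
  ... | eq rewrite dec-true (k ≟ k) refl
                 | dec-false (outerColour b ≟ next (outerColour b)) (next≢ (outerColour b) ∘ sym)
    with () ← eq

  abstract
    two-remain : ∀ l k k′ → k ≢ next l → k′ ≢ next l → does (k ≟ l) ≡ does (k′ ≟ l) → k ≡ k′
    two-remain = from-yes (all? λ l → all? λ k → all? λ k′ →
      ¬? (k ≟ next l) →-dec ¬? (k′ ≟ next l) →-dec
      (does (k ≟ l) Bool.≟ does (k′ ≟ l)) →-dec (k ≟ k′))

  count≤4 : count ≤ 4
  count≤4 = injective⇒≤ {f = label ∘ proj₁ ∘ from} λ {x} {y} eq → from-injective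
    (label-injective _ _ (proj₂ (from x)) (proj₂ (from y)) eq)
    where
    open Inverse uncovered↔count
    bit : Bool → Fin 2
    bit = Inverse.from 2↔Bool
    bit-injective : ∀ {x y} → bit x ≡ bit y → x ≡ y
    bit-injective {x} {y} eq = trans (sym (Inverse.strictlyInverseˡ 2↔Bool x))
      (trans (cong (Inverse.to 2↔Bool) eq) (Inverse.strictlyInverseˡ 2↔Bool y))
    label : E' → Fin 4
    label (inj₁ _) = 0F
    -- Only the two triangle edges at the corner `spoke b` can be uncovered in triangle `b`, and one
    -- bit separates them.
    label (inj₂ (b , k)) = combine (bit b) (bit (does (k ≟ spoke b)))
    label-injective : ∀ e e′ → stat uncovered e ≡ true → stat uncovered e′ ≡ true →
      label e ≡ label e′ → e ≡ e′
    label-injective (inj₁ f) _ z _ _ = contradiction z (old-covered f)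
    label-injective _ (inj₁ f) _ z _ = contradiction z (old-covered f)
    label-injective (inj₂ (b , k)) (inj₂ (b′ , k′)) z z′ eq
      with combine-injective (bit b) (bit (does (k ≟ spoke b))) (bit b′) (bit (does (k′ ≟ spoke b′))) eq
    ... | p , q with refl ← bit-injective {b} {b′} p =
      cong (λ x → inj₂ (b , x)) (two-remain (spoke b) k k′
        (opposite-covered b k z) (opposite-covered b k′ z′) (bit-injective q))
    from-injective : ∀ {x y} → proj₁ (from x) ≡ proj₁ (from y) → x ≡ y
    from-injective {x} {y} eq =
      trans (sym (strictlyInverseˡ x)) (trans (cong to (Σ-true-≡ eq)) (strictlyInverseˡ y))

-- Attaining the minimum.

module ArraySearch {H : Graph} (C : FiniteCubic H) where
  open FiniteCubic C
  open Matchings C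
  open Arrays C using (count)

  members : Subset nE → E H → Bool
  members s e = lookup s (Inverse.to enumE e)

  members-tabulate : ∀ M e → members (tabulate (M ∘ edg)) e ≡ M e
  members-tabulate M e =
    trans (lookup∘tabulate (M ∘ edg) _) (cong M (Inverse.strictlyInverseʳ enumE e))

  uncoveredIn : (M₁ M₂ M₃ : E H → Bool) → ℕ
  uncoveredIn M₁ M₂ M₃ = sum (λ k → ⟦ uncovered (M₁ (edg k)) (M₂ (edg k)) (M₃ (edg k)) ⟧)

  -- The search runs over triples of subsets of the finite edge set.
  array-with-count? : ∀ d → Dec (Σ (ThreeArray H) λ A → count A ≡ d)
  array-with-count? d = map′ found lost (anySubset? λ s₁ → anySubset? λ s₂ → anySubset? λ s₃ →
    perfect? (members s₁) ×-dec (perfect? (members s₂) ×-dec (perfect? (members s₃) ×-dec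
      (uncoveredIn (members s₁) (members s₂) (members s₃) ℕ.≟ d))))
    where
    Found : Set
    Found = Σ (Subset nE) λ s₁ → Σ (Subset nE) λ s₂ → Σ (Subset nE) λ s₃ →
      Perfect (members s₁) × Perfect (members s₂) × Perfect (members s₃) ×
      uncoveredIn (members s₁) (members s₂) (members s₃) ≡ d
    found : Found → Σ (ThreeArray H) λ A → count A ≡ d
    found (s₁ , s₂ , s₃ , p₁ , p₂ , p₃ , eq) = record
      { M₁ = members s₁ ; M₂ = members s₂ ; M₃ = members s₃
      ; pm₁ = perfect⇒matching p₁ ; pm₂ = perfect⇒matching p₂ ; pm₃ = perfect⇒matching p₃
      } , eq
    tabulated : ∀ {M} → PerfectMatching H M → Perfect (members (tabulate (M ∘ edg)))
    tabulated {M} pm w = ExactlyOne-cong (members-tabulate M ∘ edge w) (matching⇒perfect pm w)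
    lost : (Σ (ThreeArray H) λ A → count A ≡ d) → Found
    lost (A , eq) =
      tabulate (M₁ ∘ edg) , tabulate (M₂ ∘ edg) , tabulate (M₃ ∘ edg) ,
      tabulated pm₁ , tabulated pm₂ , tabulated pm₃ ,
      trans (sum-cong-≗ λ k → cong ⟦_⟧ (same (edg k))) eq
      where
      open ThreeArray A
      same : ∀ e → uncovered (members (tabulate (M₁ ∘ edg)) e) (members (tabulate (M₂ ∘ edg)) e)
                             (members (tabulate (M₃ ∘ edg)) e) ≡ uncovered (M₁ e) (M₂ e) (M₃ e)
      same e rewrite members-tabulate M₁ e | members-tabulate M₂ e | members-tabulate M₃ e = refl

  -- The minimum is 3 if some array attains it. If none does, every count is at least 4 and the
  -- given array is optimal.
  defect-3-or-4 : (∀ A → 3 ≤ count A) → (A : ThreeArray H) → count A ≤ 4 →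
    Σ ℕ λ d → IsDefect H d × 3 ≤ d × d ≤ 4
  defect-3-or-4 3≤ A A≤4 with array-with-count? 3
  ... | yes (B , eq) =
    3 , ((B , subst (UncoveredCount H B) eq (Arrays.uncovered↔count C B)) , least) ,
    ℕ.≤-refl , ℕ.n≤1+n 3
    where
    least : ∀ D k → UncoveredCount H D k → 3 ≤ k
    least D k Z = subst (3 ≤_) (sym (Arrays.UncoveredCount⇒≡count C D Z)) (3≤ D)
  ... | no none = count A , ((A , Arrays.uncovered↔count C A) , least) , 3≤ A , A≤4
    where
    least : ∀ D k → UncoveredCount H D k → count A ≤ k
    least D k Z = subst (count A ≤_) (sym (Arrays.UncoveredCount⇒≡count C D Z))
      (ℕ.≤-trans A≤4 (ℕ.≤∧≢⇒< (3≤ D) λ eq → none (D , sym eq)))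

-- Numbering the half-edges, and the conclusion.

cubic⇒finiteCubic : ∀ {G} → Finite G → Cubic G → FiniteCubic G
cubic⇒finiteCubic {G} ((_ , enumV) , (_ , enumE)) cubic = record
  { enumV = enumV
  ; enumE = enumE
  ; half = λ w t → proj₁ (Inverse.from (cubic w) t)
  ; index = λ e i → Inverse.to (cubic (end G e i)) ((e , i) , refl)
  ; end-half = λ w t → proj₂ (Inverse.from (cubic w) t)
  ; half-index = λ e i → cong proj₁ (Inverse.strictlyInverseʳ (cubic (end G e i)) ((e , i) , refl))
  ; index-half = λ w t →
      trans (to-end (Inverse.from (cubic w) t)) (Inverse.strictlyInverseˡ (cubic w) t)
  }
  where
  to-end : ∀ {w} (h : Half G w) →
    Inverse.to (cubic (uncurry (end G) (proj₁ h))) (proj₁ h , refl) ≡ Inverse.to (cubic w) h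
  to-end (_ , refl) = refl

-- The numbering supplied by `Cubic G` may differ from `σu` and `σv`; replacing it at `u` and `v`
-- yields `half-root`.
module Renumber {G : Graph} (_≟V_ : DecidableEquality (V G)) {w : V G}
                (σ : Half G w ↔ Fin 3) (cubic : Cubic G) where
  renumber : Cubic G
  renumber x with x ≟V w
  ... | yes refl = σ
  ... | no _ = cubic x

  renumber-at : renumber w ≡ σ
  renumber-at with w ≟V w
  ... | yes refl = refl
  ... | no w≢w = contradiction refl w≢w

  renumber-off : ∀ {x} → x ≢ w → renumber x ≡ cubic x
  renumber-off {x} x≢w with x ≟V w
  ... | yes eq = contradiction eq x≢w
  ... | no _ = refl

theorem4p2 : (G : Graph) (_≟_ : DecidableEquality (V G)) (u v : V G)
    (σu : Half G u ↔ Fin 3) (σv : Half G v ↔ Fin 3) →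
    Snark G → Adjacent G u v → NonRemovable G u v →
    Σ ℕ λ d → IsDefect (inflate2 G _≟_ u v σu σv) d × 3 ≤ d × d ≤ 4
theorem4p2 G _≟V_ u v σu σv (finite , _ , cubic , uncolourable) (e₀ , adjacent) (u≢v , colourable) =
  ArraySearch.defect-3-or-4 inflated at-least-3 array count≤4
  where
  module Rᵤ = Renumber _≟V_ σu cubic
  module Rᵥ = Renumber _≟V_ σv Rᵤ.renumber
  C : FiniteCubic G
  C = cubic⇒finiteCubic finite Rᵥ.renumber
  open Inflation G _≟V_ u v u≢v σu σv C
  half-root : ∀ b k → FiniteCubic.half C (root b) k ≡ port b k
  half-root true k = cong (λ s → proj₁ (Inverse.from s k))
    (trans (Rᵥ.renumber-off u≢v) Rᵤ.renumber-at)
  half-root false k = cong (λ s → proj₁ (Inverse.from s k)) Rᵥ.renumber-at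
  orient : (end G e₀ 0F ≡ u × end G e₀ 1F ≡ v) ⊎ (end G e₀ 0F ≡ v × end G e₀ 1F ≡ u) →
    Σ (Bool → Fin 2) λ j → ∀ b → end G e₀ (j b) ≡ root b
  orient (inj₁ (p , q)) = (λ { true → 0F ; false → 1F }) , λ { true → p ; false → q }
  orient (inj₂ (q , p)) = (λ { true → 1F ; false → 0F }) , λ { true → p ; false → q }
  open Upper G _≟V_ u v u≢v σu σv C half-root uncolourable colourable e₀ 
    (proj₁ (orient adjacent)) (proj₂ (orient adjacent))
    using (array; count≤4)
  -- At most two uncovered edges would make the inflated graph colourable, and contracting its
  -- triangles would colour `G`.
  at-least-3 : ∀ A → 3 ≤ Arrays.count inflated A
  at-least-3 A with 3 ℕ.≤? Arrays.count inflated A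
  ... | yes 3≤ = 3≤
  ... | no 3≰ = contradiction (contract-colouring
          (Arrays.few-uncovered⇒colourable inflated A (inflated-loopless colourable)
            (ℕ.≤-pred (ℕ.≰⇒> 3≰)))) uncolourable
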